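{- For integers $n\ge 1$ and $0\le k\le n-1$, $$\sum_{\sigma\in S_n}\prod_{i=1}^n [\ell_k(i;\sigma)]_q = \sum_{p\in PF_{n,k}} q^{\mathtt{area}_k(p)}.$$
   Context: Write $[n]=\{1,\dots,n\}$. A street has parking spots $1,\dots,n$ in order, and cars $c_1,\dots,c_n$ arrive in this order. A parking preference is a tuple $\alpha=(a_1,\dots,a_n)\in[n]^n$, where $a_i$ is the preferred spot of $c_i$. $k$-Naples parking rule: car $c_i$ drives to spot $a_i$; if it is empty, $c_i$ parks there. If it is occupied, $c_i$ backs up one spot at a time, checking spots $a_i-1,a_i-2,\dots$ in turn, up to at most $k$ spots behind $a_i$ (and never past spot $1$), and parks in the first empty one it finds. If all of these spots are occupied, $c_i$ goes forward and parks in the first empty spot after $a_i$, if there is one; otherwise it fails to park. The preference $\alpha$ is a $k$-Naples parking function of length $n$ if all $n$ cars park under this rule; $PF_{n,k}$ is the set of all of these. $S_n$ is the symmetric group on $[n]$, with permutations in one-line notation. The map $\varphi_k:PF_{n,k}\to S_n$ sends $\alpha$ to $s_1s_2\cdots s_n$, where spot $i$ is occupied by car $c_{s_i}$ after all cars have parked under the $k$-Naples rule. For $\sigma=s_1\cdots s_n\in S_n$ and $1\le i\le n$ (subsequences here are blocks of consecutive entries): - $\mathtt{left}_k(i;\sigma)$ is the length of the longest subsequence $s_j\cdots s_{i-1}$ such that $s_t<s_i$ for all $j\le t<i$ (equal to $0$ if it is empty). - $\mathtt{right}_k(i;\sigma)$ is the length of the longest subsequence $s_i\cdots s_r$ such that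 $r\le i+k$ (and $r\le n$) and $s_t\le s_i$ for all $i\le t\le r$. - $\ell_k(i;\sigma)=\mathtt{left}_k(i;\sigma)+\mathtt{right}_k(i;\sigma)$ if $\mathtt{left}_k(i;\sigma)=i-1$, and $\ell_k(i;\sigma)=\max(\mathtt{left}_k(i;\sigma)-k,0)+\mathtt{right}_k(i;\sigma)$ if $\mathtt{left}_k(i;\sigma)<i-1$. The $k$-Naples area of $\alpha=(a_1,\dots,a_n)\in PF_{n,k}$ is $$\mathtt{area}_k(\alpha)=\sum_{i=1}^n\left[n-i+\mathtt{right}_k(i;\varphi_k(\alpha))-a_i\right].$$ For a positive integer $m$, $[m]_q=1+q+\cdots+q^{m-1}$, where $q$ is an indeterminate. -}

module Defs where

open import Data.Bool using (Bool; true; false; if_then_else_)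
open import Data.Fin as Fin using (Fin; zero; suc; toℕ; inject₁; punchOut)
open import Data.Fin.Properties
  using (all?; any?; punchOut-injective; injective⇒≤)
open import Data.Integer as ℤ using (ℤ; +_; 0ℤ; 1ℤ)
open import Data.List as List
  using (List; []; _∷_; [_]; _++_; foldr; filter; findᵇ; mapMaybe; allFin;
         cartesianProductWith)
open import Data.List.Extrema.Nat using (max)
open import Data.List.Membership.Propositional using (_∈_)
open import Data.List.Membership.Propositional.Properties using (∈-allFin)
open import Data.List.Relation.Unary.Any using (here; there)
open import Data.Maybe as Maybe
  using (Maybe; just; nothing; is-nothing; Is-just; to-witness; _>>=_)
open import Data.Maybe.Properties using (just-injective)
open import Data.Maybe.Relation.Unary.Any as MaybeAny using (just)
open import Data.Nat as ℕ using (ℕ; zero; suc; _+_; _∸_; _≤_)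
open import Data.Nat.Properties using (1+n≰n)
open import Data.Product using (Σ; ∃; _×_; _,_; proj₁; proj₂)
open import Data.Unit using (tt)
open import Data.Vec as Vec using (Vec; []; _∷_; lookup; _[_]≔_; replicate; tabulate)
open import Data.Vec.Properties using (lookup∘update; lookup∘update′)
open import Data.Vec.Relation.Unary.AllPairs using (allPairs?)
open import Data.Vec.Relation.Unary.Unique.Propositional using (Unique)
open import Data.Vec.Relation.Unary.Unique.Propositional.Properties using (tabulate⁺)
open import Function using (_∘_)
open import Function.Definitions using (Injective)
open import Relation.Binary.PropositionalEquality
  using (_≡_; _≢_; refl; sym; trans; cong; subst)
open import Relation.Nullary using (yes; no; does; contradiction; ¬?)
open import Relation.Nullary.Decidable using (_→-dec_; _×-dec_; dec⇒maybe)
open import Relation.Unary using (Pred; Decidable)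
open import Algebra.Bundles.Raw using (RawMonoid)
import Algebra.Definitions.RawMonoid as RawMonoidOps
open import Level using (0ℓ)

private
  variable
    n k : ℕ

-- Laurent polynomials ℤ[q, q⁻¹].  The area is a priori only an integer,
-- so q^area lives here; ℤ[q] embeds as the terms of nonnegative exponent.
--
-- A finite formal sum of terms c·q^d, given as pairs (c , d).  Terms may
-- repeat; two sums are identified by _≈_ when all coefficients agree.
Laurent : Set
Laurent = List (ℤ × ℤ)

coeff : Laurent → ℤ → ℤ
coeff []            e = 0ℤ
coeff ((c , d) ∷ p) e = (if does (d ℤ.≟ e) then c else 0ℤ) ℤ.+ coeff p e

infix 4 _≈_
_≈_ : Laurent → Laurent → Set
p ≈ r = ∀ e → coeff p e ≡ coeff r e

infixl 6 _⊕_
_⊕_ : Laurent → Laurent → Laurent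
_⊕_ = _++_

infixl 7 _⊗_
_⊗_ : Laurent → Laurent → Laurent
_⊗_ = cartesianProductWith λ (c , d) (c′ , d′) → c ℤ.* c′ , d ℤ.+ d′

infix 8 q^_
q^_ : ℤ → Laurent
q^ e = [ (1ℤ , e) ]

⊕-rawMonoid ⊗-rawMonoid : RawMonoid 0ℓ 0ℓ
⊕-rawMonoid = record { _≈_ = _≈_ ; _∙_ = _⊕_ ; ε = [] }
⊗-rawMonoid = record { _≈_ = _≈_ ; _∙_ = _⊗_ ; ε = q^ 0ℤ }

∏ : (Fin n → Laurent) → Laurent
∏ = RawMonoidOps.sum ⊗-rawMonoid

∑ℤ : (Fin n → ℤ) → ℤ
∑ℤ = RawMonoidOps.sum ℤ.+-0-rawMonoid

∑ : {A : Set} → List A → (A → Laurent) → Laurent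
∑ xs f = foldr (λ x s → f x ⊕ s) [] xs

syntax ∑ xs (λ x → e) = ∑[ x ∈ xs ] e
infix 5 ∑

[_]q : ℕ → Laurent
[ m ]q = RawMonoidOps.sum ⊕-rawMonoid {m} (λ j → q^ (+ toℕ j))

-- The element i of Fin n stands for the number toℕ i + 1 of
-- {1,…,n}; this applies to spots, cars and permutation entries alike.

label : Fin n → ℕ
label i = suc (toℕ i)

Word : ℕ → Set
Word n = Vec (Fin n) n

tuples : ∀ m → List (Vec (Fin n) m)
tuples zero    = [ [] ]
tuples (suc m) = cartesianProductWith _∷_ (allFin _) (tuples m)

-- When P is a proposition this lists each x in xs satisfying P as often
-- as x occurs in xs.
restrict : {A : Set} {P : Pred A 0ℓ} → Decidable P → List A → List (∃ P)
restrict P? = mapMaybe λ x → Maybe.map (x ,_) (dec⇒maybe (P? x))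

-- Permutations in one-line notation.
S : ℕ → Set
S n = Σ (Word n) Unique

permutations : ∀ n → List (S n)
permutations n = restrict (allPairs? λ x y → ¬? (x Fin.≟ y)) (tuples n)

-- lookup L s is the car parked in spot s, if any.
Street : ℕ → Set
Street n = Vec (Maybe (Fin n)) n

behind : ℕ → Fin n → List (Fin n)
behind zero    _       = []
behind (suc k) zero    = []
behind (suc k) (suc a) = inject₁ a ∷ behind k (inject₁ a)

ahead : Fin n → List (Fin n)
ahead a = filter (a Fin.<?_) (allFin _)

-- The spots checked by a car preferring a, in the order of checking.
route : ℕ → Fin n → List (Fin n)
route k a = a ∷ behind k a ++ ahead a

empty : Street n → Fin n → Bool
empty L s = is-nothing (lookup L s)

park : ℕ → Fin n → Fin n → Street n → Maybe (Street n)
park k car a L = Maybe.map (λ s → L [ s ]≔ just car) (findᵇ (empty L) (route k a))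

parkCars : ℕ → Word n → List (Fin n) → Street n → Maybe (Street n)
parkCars k α []       L = just L
parkCars k α (c ∷ cs) L = park k c (lookup α c) L >>= parkCars k α cs

-- The final street, or nothing if some car fails to park.
outcome : ℕ → Word n → Maybe (Street n)
outcome k α = parkCars k α (allFin _) (replicate _ nothing)

IsPF : ℕ → Word n → Set
IsPF k α = Is-just (outcome k α)

PF : ℕ → ℕ → Set
PF n k = Σ (Word n) (IsPF k)

parkingFunctions : ∀ n k → List (PF n k)
parkingFunctions n k = restrict (λ α → MaybeAny.dec (λ _ → yes tt) (outcome k α)) (tuples n)

-- If all cars park then every spot holds a car, no two spots the same one

findᵇ-sound : ∀ {A : Set} (p : A → Bool) xs {x} → findᵇ p xs ≡ just x → p x ≡ true
findᵇ-sound p (y ∷ xs) eq with p y in py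
findᵇ-sound p (y ∷ xs) refl | true  = py
findᵇ-sound p (y ∷ xs) eq   | false = findᵇ-sound p xs eq

park-spec : ∀ k (c a : Fin n) L {L′} → park k c a L ≡ just L′ →
            ∃ λ s → lookup L s ≡ nothing × L′ ≡ L [ s ]≔ just c
park-spec k c a L eq with findᵇ (empty L) (route k a) in found
park-spec k c a L refl | just s
  with lookup L s in Ls | findᵇ-sound (empty L) (route k a) found
... | nothing | _ = s , Ls , refl

park-keeps : ∀ k (c a : Fin n) L {L′ s d} → park k c a L ≡ just L′ →
             lookup L s ≡ just d → lookup L′ s ≡ just d
park-keeps k c a L {s = s} eq Ls with park-spec k c a L eq
... | t , Lt , refl = trans (lookup∘update′ s≢t L (just c)) Ls
  where
  s≢t : s ≢ t
  s≢t refl with trans (sym Lt) Ls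
  ... | ()

parkCars-keeps : ∀ k (α : Word n) cs L {L′ s d} → parkCars k α cs L ≡ just L′ →
                 lookup L s ≡ just d → lookup L′ s ≡ just d
parkCars-keeps k α []       L refl Ls = Ls
parkCars-keeps k α (c ∷ cs) L eq   Ls with park k c (lookup α c) L in parked
... | just M = parkCars-keeps k α cs M eq (park-keeps k c (lookup α c) L parked Ls)

parkCars-parks : ∀ k (α : Word n) cs L {L′ c} → parkCars k α cs L ≡ just L′ →
                 c ∈ cs → ∃ λ s → lookup L′ s ≡ just c
parkCars-parks k α (c ∷ cs) L eq c∈ with park k c (lookup α c) L in parked
parkCars-parks k α (c ∷ cs) L eq (there c∈) | just M = parkCars-parks k α cs M eq c∈
parkCars-parks k α (c ∷ cs) L eq (here refl) | just M
  with park-spec k c (lookup α c) L parked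
... | s , _ , refl =
  s , parkCars-keeps k α cs (L [ s ]≔ just c) eq (lookup∘update s L (just c))

injective⇒hits : (f : Fin n → Fin n) → Injective _≡_ _≡_ f → ∀ s → ∃ λ c → f c ≡ s
injective⇒hits {suc n} f inj s with any? (λ c → f c Fin.≟ s)
... | yes hit = hit
... | no miss = contradiction (injective⇒≤ {f = g} g-inj) 1+n≰n
  where
  s≢f : ∀ c → s ≢ f c
  s≢f c eq = miss (c , sym eq)
  g : Fin (suc n) → Fin n
  g c = punchOut (s≢f c)
  g-inj : Injective _≡_ _≡_ g
  g-inj {c} {d} eq = inj (punchOut-injective (s≢f c) (s≢f d) eq)

to-witness-≡ : ∀ {A : Set} {m : Maybe A} (p : Is-just m) → m ≡ just (to-witness p)
to-witness-≡ (just _) = refl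

module _ (k : ℕ) (α : Word n) (pf : IsPF k α) where

  finalStreet : Street n
  finalStreet = to-witness pf

  outcome≡ : outcome k α ≡ just finalStreet
  outcome≡ = to-witness-≡ pf

  spotOf : ∀ c → ∃ λ s → lookup finalStreet s ≡ just c
  spotOf c = parkCars-parks k α (allFin n) (replicate n nothing) outcome≡ (∈-allFin c)

  spotOf-injective : Injective _≡_ _≡_ (proj₁ ∘ spotOf)
  spotOf-injective {c} {d} eq = just-injective
    (trans (sym (proj₂ (spotOf c)))
           (trans (cong (lookup finalStreet) eq) (proj₂ (spotOf d))))

  occupant : ∀ s → ∃ λ c → proj₁ (spotOf c) ≡ s
  occupant = injective⇒hits (proj₁ ∘ spotOf) spotOf-injective

  occupied : ∀ s → Is-just (lookup finalStreet s)
  occupied s with occupant s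
  ... | c , refl = subst Is-just (sym (proj₂ (spotOf c))) (just tt)

  parkedIn : Fin n → Fin n
  parkedIn s = to-witness (occupied s)

  lookup-parkedIn : ∀ s → lookup finalStreet s ≡ just (parkedIn s)
  lookup-parkedIn s = to-witness-≡ (occupied s)

  parkedIn-occupant : ∀ s → proj₁ (occupant s) ≡ parkedIn s
  parkedIn-occupant s = just-injective
    (trans (sym (proj₂ (spotOf (proj₁ (occupant s)))))
           (trans (cong (lookup finalStreet) (proj₂ (occupant s))) (lookup-parkedIn s)))

  parkedIn-injective : ∀ {s t} → parkedIn s ≡ parkedIn t → s ≡ t
  parkedIn-injective {s} {t} eq =
    trans (sym (proj₂ (occupant s))) (trans (cong (proj₁ ∘ spotOf) c≡d) (proj₂ (occupant t)))
    where
    c≡d : proj₁ (occupant s) ≡ proj₁ (occupant t)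
    c≡d = trans (parkedIn-occupant s) (trans eq (sym (parkedIn-occupant t)))

φ : ∀ k → PF n k → S n
φ k (α , pf) = tabulate (parkedIn k α pf) , tabulate⁺ (parkedIn-injective k α pf)

entry : S n → Fin n → Fin n
entry (w , _) = lookup w

-- The block s_j ⋯ s_{i-1}, empty for j = i, has all entries less than s_i.
LeftBlock : S n → Fin n → Fin n → Set
LeftBlock σ i j =
  j Fin.≤ i × (∀ t → j Fin.≤ t → t Fin.< i → entry σ t Fin.< entry σ i)

-- The block s_i ⋯ s_r, with i ≤ r ≤ i + k, has all entries at most s_i.
RightBlock : ℕ → S n → Fin n → Fin n → Set
RightBlock k σ i r =
  i Fin.≤ r × toℕ r ≤ toℕ i + k ×
  (∀ t → i Fin.≤ t → t Fin.≤ r → entry σ t Fin.≤ entry σ i)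

leftBlock? : (σ : S n) (i : Fin n) → Decidable (LeftBlock σ i)
leftBlock? σ i j = (j Fin.≤? i) ×-dec
  all? λ t → (j Fin.≤? t) →-dec ((t Fin.<? i) →-dec (entry σ t Fin.<? entry σ i))

rightBlock? : ∀ k (σ : S n) (i : Fin n) → Decidable (RightBlock k σ i)
rightBlock? k σ i r = (i Fin.≤? r) ×-dec (toℕ r ℕ.≤? toℕ i + k) ×-dec
  all? λ t → (i Fin.≤? t) →-dec ((t Fin.≤? r) →-dec (entry σ t Fin.≤? entry σ i))

-- The maximal length of such blocks; left does not depend on k.
left : S n → Fin n → ℕ
left σ i = max 0 (List.map (λ j → toℕ i ∸ toℕ j) (filter (leftBlock? σ i) (allFin _)))

right : ℕ → S n → Fin n → ℕ
right k σ i =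
  max 0 (List.map (λ r → suc (toℕ r) ∸ toℕ i) (filter (rightBlock? k σ i) (allFin _)))

-- toℕ i is the number of positions before i.  Since left σ i ≤ toℕ i, the
-- second branch is the case left σ i < toℕ i.
ℓ : ℕ → S n → Fin n → ℕ
ℓ k σ i = if does (left σ i ℕ.≟ toℕ i)
          then left σ i + right k σ i
          else (left σ i ∸ k) + right k σ i

area : ∀ k → PF n k → ℤ
area {n} k p@(α , _) = ∑ℤ λ i →
  + n ℤ.- + label i ℤ.+ + right k (φ k p) i ℤ.- + label (lookup α i)

{-# OPTIONS --safe #-}
-- Fix σ.  The cars parked before the car of spot i are the smaller entries of
-- σ, so the preferences a that send this car to i form an interval: in 0-based
-- spots, those with suc a + d = i + right k σ i for some slack d < ℓ k σ i.
-- Choosing the slacks independently for all i gives each parking function with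
-- outcome σ exactly once, and its area is the sum of its slacks, whence the
-- factor [ ℓ k σ i ]q for each spot.

module Submission where

open import Defs
open import Data.Bool using (Bool; true; false; if_then_else_)
open import Data.Bool.Properties using (if-float)
open import Data.Fin as Fin using (Fin; zero; suc; toℕ; inject₁; fromℕ<)
open import Data.Fin.Permutation using (permutation; reverse)
open import Data.Fin.Properties
  using (toℕ-inject₁; toℕ-injective; toℕ<n; toℕ-fromℕ<; opposite-prop)
  renaming (<-cmp to Fin-<-cmp)
open import Data.Integer as ℤ using (ℤ; 1ℤ)
import Data.Integer.Properties as ℤₚ
open import Data.List as List
  using (List; []; _∷_; _++_; map; filter; findᵇ; allFin; upTo; applyUpTo;
         cartesianProductWith; concatMap)
open import Data.List.Extrema.Nat using (max; xs≤max; argmax-sel)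
open import Data.List.Membership.Propositional using (_∈_; find; lose)
open import Data.List.Membership.Propositional.Properties
  using (∈-map⁺; ∈-map⁻; ∈-++⁺ˡ; ∈-++⁺ʳ; ∈-++⁻; ∈-filter⁺; ∈-filter⁻; ∈-allFin;
         ∈-upTo⁺; ∈-upTo⁻; ∈-cartesianProductWith⁺; ∈-cartesianProductWith⁻;
         ∈-concatMap⁺; ∈-concatMap⁻)
open import Data.List.Membership.Propositional.Properties.WithK using (unique∧set⇒bag)
open import Data.List.Properties
  using (map-∘; map-cong; map-++; map-concatMap; concatMap-cong)
open import Data.List.Relation.Binary.BagAndSetEquality using (∼bag⇒↭)
open import Data.List.Relation.Binary.Disjoint.Propositional using (Disjoint)
open import Data.List.Relation.Binary.Permutation.Propositional
  using (_↭_; refl; prep; swap) renaming (trans to ↭-trans)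
import Data.List.Relation.Binary.Permutation.Propositional.Properties as ↭
open import Data.List.Relation.Unary.All as All using (All; []; _∷_)
import Data.List.Relation.Unary.All.Properties as Allₚ
open import Data.List.Relation.Unary.AllPairs as AllPairs using (AllPairs; []; _∷_)
import Data.List.Relation.Unary.AllPairs.Properties as AllPairsₚ
open import Data.List.Relation.Unary.Any using (here; there)
import Data.List.Relation.Unary.Unique.Propositional as L
import Data.List.Relation.Unary.Unique.Propositional.Properties as Uniqueₚ
open import Data.Maybe as Maybe using (Maybe; just; nothing; is-nothing; Is-just; _>>=_)
open import Data.Maybe.Properties using (just-injective)
open import Data.Maybe.Relation.Unary.Any as MaybeAny using (just)
open import Data.Nat as ℕ using (ℕ; zero; suc; _+_; _∸_; _≤_; _<_; z≤n; s≤s)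
open import Data.Nat.Properties as ℕₚ
open import Data.Product using (∃; _×_; _,_; proj₁; proj₂)
open import Data.Sum using (_⊎_; inj₁; inj₂)
open import Data.Unit using (tt)
open import Data.Vec as Vec using (Vec; []; _∷_; lookup; _[_]≔_; replicate; tabulate)
open import Data.Vec.Properties
  using (lookup∘update; lookup∘update′; lookup∘tabulate; tabulate∘lookup; tabulate-cong;
         lookup-replicate; ∷-injective)
open import Data.Vec.Relation.Unary.AllPairs using (allPairs?)
open import Data.Vec.Relation.Unary.Unique.Propositional using (Unique)
open import Data.Vec.Relation.Unary.Unique.Propositional.Properties using (lookup-injective)
open import Function using (_∘_; _on_; id; flip)
open import Function.Bundles using (mk⇔)
open import Function.Definitions using (Injective)
open import Relation.Binary using (tri<; tri≈; tri>)
open import Relation.Binary.PropositionalEquality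
  using (_≡_; _≢_; _≗_; refl; sym; trans; cong; cong₂; subst; subst₂; module ≡-Reasoning)
open import Relation.Nullary using (¬_; ¬?; yes; no; does; contradiction)
open import Relation.Nullary.Decidable using (dec-true; dec-false; toSum)
open import Relation.Unary using (Pred; Decidable)
import Algebra.Definitions.RawMonoid as RawMonoidOps
open import Level using (0ℓ)
import Algebra.Properties.CommutativeMonoid.Sum ℤₚ.+-0-commutativeMonoid as ℤSum
open import Algebra.Properties.CommutativeSemigroup ℤₚ.+-commutativeSemigroup
  using (x∙yz≈y∙xz)

private
  variable
    n : ℕ
    A B C : Set

-- Laurent polynomials as lists of terms

termCoeff : ℤ × ℤ → ℤ → ℤ
termCoeff (c , d) e = if does (d ℤ.≟ e) then c else ℤ.0ℤ

-- A coefficient is a sum over all terms, so their order does not matter. This reduces the theorem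
-- to a rearrangement of one list of terms into another.
coeff-↭ : ∀ {p r} → p ↭ r → p ≈ r
coeff-↭ refl            e = refl
coeff-↭ (prep x p↭r)    e = cong (ℤ._+_ (termCoeff x e)) (coeff-↭ p↭r e)
coeff-↭ {r = _ ∷ _ ∷ r} (swap x y p↭r) e =
  trans (cong (λ c → termCoeff x e ℤ.+ (termCoeff y e ℤ.+ c)) (coeff-↭ p↭r e))
        (x∙yz≈y∙xz (termCoeff x e) (termCoeff y e) (coeff r e))
coeff-↭ (↭-trans p↭r r↭s) e = trans (coeff-↭ p↭r e) (coeff-↭ r↭s e)

-- One vector for each term of the expanded product of the `[ m i ]q`; the sum of its entries is the
-- exponent of that term.
box : (Fin n → ℕ) → List (Vec ℕ n)
box {zero}  m = List.[ [] ]
box {suc n} m = cartesianProductWith _∷_ (upTo (m zero)) (box (m ∘ suc))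

∈-box⁺ : (m : Fin n → ℕ) {d : Vec ℕ n} → (∀ i → lookup d i < m i) → d ∈ box m
∈-box⁺ {zero}  m {[]}    d<m = here refl
∈-box⁺ {suc n} m {x ∷ d} d<m =
  ∈-cartesianProductWith⁺ _∷_ (∈-upTo⁺ (d<m zero)) (∈-box⁺ (m ∘ suc) (d<m ∘ suc))

∈-box⁻ : (m : Fin n → ℕ) {d : Vec ℕ n} → d ∈ box m → ∀ i → lookup d i < m i
∈-box⁻ {suc n} m d∈ i
  with ∈-cartesianProductWith⁻ _∷_ (upTo (m zero)) (box (m ∘ suc)) d∈
∈-box⁻ {suc n} m d∈ zero    | _ , _ , x∈ , _ , refl = ∈-upTo⁻ x∈
∈-box⁻ {suc n} m d∈ (suc i) | _ , _ , _ , d∈′ , refl = ∈-box⁻ (m ∘ suc) d∈′ i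

box-unique : (m : Fin n → ℕ) → L.Unique (box m)
box-unique {zero}  m = [] ∷ []
box-unique {suc n} m =
  Uniqueₚ.cartesianProductWith⁺ _∷_ ∷-injective (Uniqueₚ.upTo⁺ (m zero)) (box-unique (m ∘ suc))

monomial : ℕ → ℤ × ℤ
monomial e = 1ℤ , ℤ.+ e

[]q-terms : ∀ m → [ m ]q ≡ map monomial (upTo m)
[]q-terms = go id
  where
  -- Each step of the recursion shifts the exponents, hence the general `f`; `upTo m` is the case
  -- `f = id`.
  go : ∀ (f : ℕ → ℕ) m →
       RawMonoidOps.sum ⊕-rawMonoid {m} (λ j → q^ (ℤ.+ f (toℕ j))) ≡
       map monomial (applyUpTo f m)
  go f zero    = refl
  go f (suc m) = cong (monomial (f 0) ∷_) (go (f ∘ suc) m)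

-- The equality holds for lists, not only up to `_≈_`, because `_⊗_` and the product of the index
-- lists run through the pairs in the same order.
⊗-terms : (f : A → ℕ) (g : B → ℕ) (h : C → ℕ) (_∙_ : A → B → C) →
          (∀ x y → f x + g y ≡ h (x ∙ y)) → ∀ xs ys →
          map (monomial ∘ f) xs ⊗ map (monomial ∘ g) ys ≡
          map (monomial ∘ h) (cartesianProductWith _∙_ xs ys)
⊗-terms f g h _∙_ f+g≡h []       ys = refl
⊗-terms f g h _∙_ f+g≡h (x ∷ xs) ys =
  trans (cong₂ _++_
          (trans (sym (map-∘ ys))
                 (trans (map-cong (λ y → cong monomial (f+g≡h x y)) ys) (map-∘ ys)))
          (⊗-terms f g h _∙_ f+g≡h xs ys))
        (sym (map-++ _ (map (x ∙_) ys) _))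

∏[]q-terms : (m : Fin n → ℕ) → ∏ (λ i → [ m i ]q) ≡ map (monomial ∘ Vec.sum) (box m)
∏[]q-terms {zero}  m = refl
∏[]q-terms {suc n} m =
  trans (cong₂ _⊗_ ([]q-terms (m zero)) (∏[]q-terms (m ∘ suc)))
        (⊗-terms id Vec.sum Vec.sum _∷_ (λ _ _ → refl) (upTo (m zero)) (box (m ∘ suc)))

∑≡concatMap : (xs : List A) (f : A → Laurent) → ∑ xs f ≡ concatMap f xs
∑≡concatMap []       f = refl
∑≡concatMap (x ∷ xs) f = cong (f x ++_) (∑≡concatMap xs f)

∑-q^ : (xs : List A) (f : A → ℤ) → ∑ xs (λ x → q^ f x) ≡ map (λ x → 1ℤ , f x) xs
∑-q^ []       f = refl
∑-q^ (x ∷ xs) f = cong (_ ∷_) (∑-q^ xs f)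

-- Enumerations without repetition

tuples-unique : ∀ m → L.Unique (tuples {n} m)
tuples-unique zero    = [] ∷ []
tuples-unique (suc m) =
  Uniqueₚ.cartesianProductWith⁺ _∷_ ∷-injective (Uniqueₚ.allFin⁺ _) (tuples-unique m)

∈-tuples : ∀ {m} (v : Vec (Fin n) m) → v ∈ tuples m
∈-tuples []      = here refl
∈-tuples (a ∷ v) = ∈-cartesianProductWith⁺ _∷_ (∈-allFin a) (∈-tuples v)

map-proj₁-restrict : {P : Pred A 0ℓ} (P? : Decidable P) (xs : List A) →
                     map proj₁ (restrict P? xs) ≡ filter P? xs
map-proj₁-restrict P? []       = refl
map-proj₁-restrict P? (x ∷ xs) with P? x
... | yes _ = cong (x ∷_) (map-proj₁-restrict P? xs)
... | no  _ = map-proj₁-restrict P? xs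

-- Distinctness concerns the first components, so that proofs of `P` never have to be compared.
restrict-unique : {P : Pred A 0ℓ} (P? : Decidable P) {xs : List A} → L.Unique xs →
                  AllPairs (_≢_ on proj₁) (restrict P? xs)
restrict-unique P? {xs} xs! =
  AllPairsₚ.map⁻ (subst L.Unique (sym (map-proj₁-restrict P? xs)) (Uniqueₚ.filter⁺ P? xs!))

-- The listed proof is the one computed by `P?`, which may differ from the given one; hence the
-- existential.
∈-restrict : {P : Pred A 0ℓ} (P? : Decidable P) {xs : List A} {x : A} → x ∈ xs → P x →
             ∃ λ px → (x , px) ∈ restrict P? xs
∈-restrict P? {xs} x∈xs px
  with ∈-map⁻ proj₁ (subst (_ ∈_) (sym (map-proj₁-restrict P? xs)) (∈-filter⁺ P? x∈xs px))
... | (_ , px′) , x∈ , refl = px′ , x∈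

-- Searching the route

findᵇ-∈ : (e : A → Bool) (xs : List A) {x : A} → findᵇ e xs ≡ just x → x ∈ xs
findᵇ-∈ e (y ∷ xs) eq with e y
findᵇ-∈ e (y ∷ xs) refl | true  = here refl
findᵇ-∈ e (y ∷ xs) eq   | false = there (findᵇ-∈ e xs eq)

module _ {R : A → A → Set} where

  -- Sortedness puts everything listed before `x` in relation `R` to `x`, so the search passes over
  -- all of it.
  findᵇ-first : ∀ e {xs x} → AllPairs R xs → x ∈ xs → e x ≡ true →
                (∀ {y} → y ∈ xs → R y x → e y ≡ false) → findᵇ e xs ≡ just x
  findᵇ-first e {y ∷ xs} (_ ∷ _)  (here refl) ex before rewrite ex = refl
  findᵇ-first e {y ∷ xs} (Ry ∷ Rxs) (there x∈)  ex before
    rewrite before (here refl) (All.lookup Ry x∈) =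
    findᵇ-first e Rxs x∈ ex (before ∘ there)

  -- By asymmetry a `y` with `R y x` can be neither `x` nor listed after it, so the search has
  -- already rejected it.
  findᵇ-before : (∀ {x y} → R x y → ¬ R y x) → ∀ e {xs x y} → AllPairs R xs →
                 findᵇ e xs ≡ just x → y ∈ xs → R y x → e y ≡ false
  findᵇ-before asym e {z ∷ xs} (Rz ∷ Rxs) eq y∈ Ryx with e z in ez
  findᵇ-before asym e {z ∷ xs} (Rz ∷ Rxs) refl (here refl) Ryx | true =
    contradiction Ryx (asym Ryx)
  findᵇ-before asym e {z ∷ xs} (Rz ∷ Rxs) refl (there y∈)  Ryx | true =
    contradiction Ryx (asym (All.lookup Rz y∈))
  findᵇ-before asym e {z ∷ xs} (Rz ∷ Rxs) eq (here refl) Ryx | false = ez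
  findᵇ-before asym e {z ∷ xs} (Rz ∷ Rxs) eq (there y∈)  Ryx | false =
    findᵇ-before asym e Rxs eq y∈ Ryx

∈-behind⁻ : ∀ k {a t : Fin n} → t ∈ behind k a → t Fin.< a × toℕ a ≤ toℕ t + k
∈-behind⁻ (suc k) {suc a} {t} (here refl) rewrite toℕ-inject₁ a | +-suc (toℕ a) k =
  ≤-refl , s≤s (m≤m+n (toℕ a) k)
∈-behind⁻ (suc k) {suc a} {t} (there t∈)
  with t<a , a≤ ← ∈-behind⁻ k t∈ rewrite toℕ-inject₁ a | +-suc (toℕ t) k =
  m≤n⇒m≤1+n t<a , s≤s a≤

∈-behind⁺ : ∀ k {a t : Fin n} → t Fin.< a → toℕ a ≤ toℕ t + k → t ∈ behind k a
∈-behind⁺ zero {a} {t} t<a a≤ =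
  contradiction (subst (toℕ a ≤_) (+-identityʳ _) a≤) (<⇒≱ t<a)
∈-behind⁺ (suc k) {suc a} {t} (s≤s t≤a) a≤ with toℕ t ℕ.≟ toℕ a
... | yes t≡a = here (toℕ-injective (trans t≡a (sym (toℕ-inject₁ a))))
... | no  t≢a = there (∈-behind⁺ k
  (subst (toℕ t <_) (sym (toℕ-inject₁ a)) (≤∧≢⇒< t≤a t≢a))
  (subst (_≤ toℕ t + k) (sym (toℕ-inject₁ a))
    (≤-pred (subst (suc (toℕ a) ≤_) (+-suc _ k) a≤))))

behind-sorted : ∀ k (a : Fin n) → AllPairs (flip Fin._<_) (behind k a)
behind-sorted zero    a       = []
behind-sorted (suc k) zero    = []
behind-sorted (suc k) (suc a) =
  All.tabulate (proj₁ ∘ ∈-behind⁻ k) ∷ behind-sorted k (inject₁ a)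

ahead-sorted : (a : Fin n) → AllPairs Fin._<_ (ahead a)
ahead-sorted a = AllPairsₚ.filter⁺ (a Fin.<?_) (AllPairsₚ.tabulate⁺-< id)

-- Backing up at most `k` spots, stopping at the first spot and driving forward without limit all
-- merge into this one bound.
∈-route⁻ : ∀ k {a t : Fin n} → t ∈ route k a → toℕ a ≤ toℕ t + k
∈-route⁻ k {a} (here refl) = m≤m+n (toℕ a) k
∈-route⁻ k {a} {t} (there t∈) with ∈-++⁻ (behind k a) t∈
... | inj₁ t∈behind = proj₂ (∈-behind⁻ k t∈behind)
... | inj₂ t∈ahead  =
  ≤-trans (<⇒≤ (proj₂ (∈-filter⁻ (a Fin.<?_) {xs = allFin _} t∈ahead))) (m≤m+n (toℕ t) k)

∈-route⁺ : ∀ k {a t : Fin n} → toℕ a ≤ toℕ t + k → t ∈ route k a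
∈-route⁺ k {a} {t} a≤ with Fin-<-cmp t a
... | tri< t<a _ _  = there (∈-++⁺ˡ (∈-behind⁺ k t<a a≤))
... | tri≈ _ refl _ = here refl
... | tri> _ _ a<t  = there (∈-++⁺ʳ (behind k a) (∈-filter⁺ (a Fin.<?_) (∈-allFin t) a<t))

-- A car preferring a checks t before u.
Before : Fin n → Fin n → Fin n → Set
Before a t u = (u Fin.< t × t Fin.≤ a) ⊎ (t Fin.< u × a Fin.< u)

Before-asym : {a t u : Fin n} → Before a t u → ¬ Before a u t
Before-asym (inj₁ (u<t , _))   (inj₁ (t<u , _))   = <-asym u<t t<u
Before-asym (inj₁ (_ , t≤a))   (inj₂ (_ , a<t))   = <⇒≱ a<t t≤a
Before-asym (inj₂ (_ , a<u))   (inj₁ (_ , u≤a))   = <⇒≱ a<u u≤a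
Before-asym (inj₂ (t<u , _))   (inj₂ (u<t , _))   = <-asym u<t t<u

AllPairs-All : {P : A → Set} {R : A → A → Set} {xs : List A} → All P xs → AllPairs R xs →
               AllPairs (λ x y → P x × P y × R x y) xs
AllPairs-All []         []         = []
AllPairs-All (px ∷ pxs) (Rx ∷ Rxs) =
  All.zipWith (px ,_) (pxs , Rx) ∷ AllPairs-All pxs Rxs

-- The route is `a`, then a decreasing list below `a`, then an increasing list above `a`; `Before a`
-- covers each block and each passage between blocks.
route-sorted : ∀ k (a : Fin n) → AllPairs (Before a) (route k a)
route-sorted k a =
  Allₚ.++⁺ (All.map (λ t<a → inj₁ (t<a , ≤-refl)) behind<a)
           (All.map (λ a<t → inj₂ (a<t , a<t)) a<ahead) ∷
  AllPairsₚ.++⁺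
    (AllPairs.map (λ (t<a , _ , u<t) → inj₁ (u<t , <⇒≤ t<a))
      (AllPairs-All behind<a (behind-sorted k a)))
    (AllPairs.map (λ (_ , a<u , t<u) → inj₂ (t<u , a<u))
      (AllPairs-All a<ahead (ahead-sorted a)))
    (All.map (λ t<a → All.map (λ a<u → inj₂ (<-trans t<a a<u , a<u)) a<ahead) behind<a)
  where
  behind<a : All (Fin._< a) (behind k a)
  behind<a = All.tabulate (proj₁ ∘ ∈-behind⁻ k)
  a<ahead : All (a Fin.<_) (ahead a)
  a<ahead = All.tabulate (proj₂ ∘ ∈-filter⁻ (a Fin.<?_) {xs = allFin _})

findᵇ-route⁺ : ∀ k (e : Fin n → Bool) {a i} → toℕ a ≤ toℕ i + k → e i ≡ true →
               (∀ t → toℕ a ≤ toℕ t + k → Before a t i → e t ≡ false) →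
               findᵇ e (route k a) ≡ just i
findᵇ-route⁺ k e {a} a≤ ei before =
  findᵇ-first e (route-sorted k a) (∈-route⁺ k a≤) ei (λ t∈ → before _ (∈-route⁻ k t∈))

findᵇ-route⁻ : ∀ k (e : Fin n → Bool) {a i} → findᵇ e (route k a) ≡ just i →
               toℕ a ≤ toℕ i + k × (∀ t → toℕ a ≤ toℕ t + k → Before a t i → e t ≡ false)
findᵇ-route⁻ k e {a} found =
  ∈-route⁻ k (findᵇ-∈ e (route k a) found) ,
  λ t a≤ → findᵇ-before Before-asym e (route-sorted k a) found (∈-route⁺ k a≤)

-- The preferences that lead to a given spot

m∸n≤o⇒m≤n+o : ∀ {m n o} → m ∸ n ≤ o → m ≤ n + o
m∸n≤o⇒m≤n+o {m} {n} m∸n≤o = ≤-trans (m≤n+m∸n m n) (+-monoʳ-≤ n m∸n≤o)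

module _ {P : Pred (Fin n) 0ℓ} (P? : Decidable P) (f : Fin n → ℕ) where

  private
    maximum : ℕ
    maximum = max 0 (map f (filter P? (allFin n)))

  ≤-maximum : ∀ {i} → P i → f i ≤ maximum
  ≤-maximum {i} pi = All.lookup (xs≤max 0 _) (∈-map⁺ f (∈-filter⁺ P? (∈-allFin i) pi))

  -- `max` starts from the default `0`, so a maximum of `0` need not come from any `i`.
  maximum-attained : maximum ≡ 0 ⊎ ∃ λ i → P i × maximum ≡ f i
  maximum-attained with argmax-sel id 0 (map f (filter P? (allFin n)))
  ... | inj₁ ≡0 = inj₁ ≡0
  ... | inj₂ ∈f with ∈-map⁻ f ∈f
  ... | i , i∈ , eq = inj₂ (i , proj₂ (∈-filter⁻ P? {xs = allFin n} i∈) , eq)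

module _ (k : ℕ) (σ : S n) (i : Fin n) where

  private
    l r : ℕ
    l = left σ i
    r = right k σ i

  RightBlock⇒< : ∀ {j} → RightBlock k σ i j → toℕ j < toℕ i + r
  RightBlock⇒< {j} block =
    m∸n≤o⇒m≤n+o (≤-maximum (rightBlock? k σ i) _ block)

  -- A shortened right block is again one, so the ends of right blocks fill the whole range up to
  -- the end of the longest.
  <⇒RightBlock : ∀ {j} → i Fin.≤ j → toℕ j < toℕ i + r → RightBlock k σ i j
  <⇒RightBlock {j} i≤j j< with maximum-attained (rightBlock? k σ i) (λ j → suc (toℕ j) ∸ toℕ i)
  ... | inj₁ r≡0 =
    contradiction (subst (toℕ j <_) (trans (cong (toℕ i +_) r≡0) (+-identityʳ _)) j<) (≤⇒≯ i≤j)
  ... | inj₂ (j′ , (i≤j′ , j′≤ , block) , r≡) =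
    i≤j , ≤-trans j≤j′ j′≤ , λ t i≤t t≤j → block t i≤t (≤-trans t≤j j≤j′)
    where
    j≤j′ : j Fin.≤ j′
    j≤j′ = ≤-pred (subst (toℕ j <_)
      (trans (cong (toℕ i +_) r≡) (m+[n∸m]≡n (m≤n⇒m≤1+n i≤j′))) j<)

  right-bound : toℕ i + r ≤ n
  right-bound with maximum-attained (rightBlock? k σ i) (λ j → suc (toℕ j) ∸ toℕ i)
  ... | inj₁ r≡0 =
    subst (_≤ n) (sym (trans (cong (toℕ i +_) r≡0) (+-identityʳ _))) (<⇒≤ (toℕ<n i))
  ... | inj₂ (j , (i≤j , _) , r≡) =
    subst (_≤ n) (sym (trans (cong (toℕ i +_) r≡) (m+[n∸m]≡n (m≤n⇒m≤1+n i≤j)))) (toℕ<n j)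

  LeftBlock⇒≤ : ∀ {j} → LeftBlock σ i j → toℕ i ≤ toℕ j + l
  LeftBlock⇒≤ {j} block = m∸n≤o⇒m≤n+o (≤-maximum (leftBlock? σ i) _ block)

  ≤⇒LeftBlock : ∀ {j} → j Fin.≤ i → toℕ i ≤ toℕ j + l → LeftBlock σ i j
  ≤⇒LeftBlock {j} j≤i i≤ with maximum-attained (leftBlock? σ i) (λ j → toℕ i ∸ toℕ j)
  -- With `l` equal to `0` only `j = i` is left, and its block is empty.
  ... | inj₁ l≡0 = j≤i , λ t j≤t t<i → contradiction
    (≤-trans (subst (toℕ i ≤_) (trans (cong (toℕ j +_) l≡0) (+-identityʳ _)) i≤) j≤t)
    (<⇒≱ t<i)
  ... | inj₂ (j′ , (j′≤i , block) , l≡) = j≤i , λ t j≤t → block t (≤-trans j′≤j j≤t)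
    where
    j′≤j : j′ Fin.≤ j
    j′≤j = +-cancelʳ-≤ (toℕ i ∸ toℕ j′) _ _ (begin
      toℕ j′ + (toℕ i ∸ toℕ j′) ≡⟨ m+[n∸m]≡n j′≤i ⟩
      toℕ i                     ≤⟨ i≤ ⟩
      toℕ j + l                 ≡⟨ cong (toℕ j +_) l≡ ⟩
      toℕ j + (toℕ i ∸ toℕ j′)  ∎)
      where open ≤-Reasoning

  left≤ : l ≤ toℕ i
  left≤ with maximum-attained (leftBlock? σ i) (λ j → toℕ i ∸ toℕ j)
  ... | inj₁ l≡0           = subst (_≤ toℕ i) (sym l≡0) z≤n
  ... | inj₂ (j , _ , l≡) = subst (_≤ toℕ i) (sym l≡) (m∸n≤m (toℕ i) (toℕ j))

  -- The number of spots before i from which a car can be driven forward to i.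
  reach : ℕ
  reach = if does (l ℕ.≟ toℕ i) then l else l ∸ k

  reach-full : l ≡ toℕ i → reach ≡ l
  reach-full l≡i = cong (if_then l else l ∸ k) (dec-true (l ℕ.≟ toℕ i) l≡i)

  reach-partial : l ≢ toℕ i → reach ≡ l ∸ k
  reach-partial l≢i = cong (if_then l else l ∸ k) (dec-false (l ℕ.≟ toℕ i) l≢i)

  reach+right : reach + r ≡ ℓ k σ i
  reach+right = if-float (_+ r) (does (l ℕ.≟ toℕ i))

  reach≤ : reach ≤ toℕ i
  reach≤ with toSum (l ℕ.≟ toℕ i)
  ... | inj₁ l≡i = subst (_≤ toℕ i) (sym (reach-full l≡i)) left≤
  ... | inj₂ l≢i = subst (_≤ toℕ i) (sym (reach-partial l≢i)) (≤-trans (m∸n≤m l k) left≤)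

  -- For `a` before `i`, the spots checked earlier than `i` are those from `k` behind `a` (or the
  -- first spot) up to just before `i`.
  Clear : Fin n → Set
  Clear a = ∀ t → toℕ a ≤ toℕ t + k → t Fin.< i → entry σ t Fin.< entry σ i

  -- It suffices that the longest left block contains every such `t`. If it starts at the first spot
  -- it contains all spots before `i`; otherwise the `k` subtracted in `reach` makes room for the
  -- backing up.
  ≤reach⇒Clear : ∀ {a} → a Fin.< i → toℕ i ≤ toℕ a + reach → Clear a
  ≤reach⇒Clear {a} a<i i≤ t a≤t+k t<i = proj₂ (≤⇒LeftBlock (<⇒≤ t<i) i≤t+l) t ≤-refl t<i
    where
    i≤t+l : toℕ i ≤ toℕ t + l
    i≤t+l with toSum (l ℕ.≟ toℕ i)
    ... | inj₁ l≡i = subst (λ x → toℕ i ≤ toℕ t + x) (sym l≡i) (m≤n+m _ _)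
    ... | inj₂ l≢i = begin
      toℕ i                 ≤⟨ i≤ ⟩
      toℕ a + reach         ≡⟨ cong (toℕ a +_) (reach-partial l≢i) ⟩
      toℕ a + (l ∸ k)       ≤⟨ +-monoˡ-≤ (l ∸ k) a≤t+k ⟩
      toℕ t + k + (l ∸ k)   ≡⟨ +-assoc (toℕ t) k _ ⟩
      toℕ t + (k + (l ∸ k)) ≡⟨ cong (toℕ t +_) (m+[n∸m]≡n k≤l) ⟩
      toℕ t + l             ∎
      where
      open ≤-Reasoning
      -- Otherwise the truncated `l ∸ k` is `0`, and `i≤` contradicts `a<i`.
      k≤l : k ≤ l
      k≤l with k ℕ.≤? l
      ... | yes k≤l = k≤l
      ... | no  k≰l = contradiction
        (subst (toℕ i ≤_)
          (trans (cong (toℕ a +_) (trans (reach-partial l≢i) (m≤n⇒m∸n≡0 (≰⇒≥ k≰l))))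
                 (+-identityʳ _)) i≤)
        (<⇒≱ a<i)

  Clear⇒≤reach : ∀ {a} → a Fin.< i → Clear a → toℕ i ≤ toℕ a + reach
  Clear⇒≤reach {a} a<i clear with toSum (l ℕ.≟ toℕ i)
  ... | inj₁ l≡i =
    subst (λ x → toℕ i ≤ toℕ a + x) (sym (trans (reach-full l≡i) l≡i)) (m≤n+m _ _)
  ... | inj₂ l≢i = subst (λ x → toℕ i ≤ toℕ a + x) (sym (reach-partial l≢i)) i≤
    where
    -- The last spot checked while backing up, and so the start of a left block.
    b : ℕ
    b = toℕ a ∸ k
    b<i : b < toℕ i
    b<i = ≤-<-trans (m∸n≤m (toℕ a) k) a<i
    j : Fin n
    j = fromℕ< (<-trans b<i (toℕ<n i))
    j≡ : toℕ j ≡ b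
    j≡ = toℕ-fromℕ< _
    i≤b+l : toℕ i ≤ b + l
    i≤b+l = subst (λ x → toℕ i ≤ x + l) j≡ (LeftBlock⇒≤
      (subst (_≤ toℕ i) (sym j≡) (<⇒≤ b<i) ,
       λ t j≤t t<i → clear t (a≤t+k (subst (_≤ toℕ t) j≡ j≤t)) t<i))
      where
      a≤t+k : ∀ {t} → b ≤ toℕ t → toℕ a ≤ toℕ t + k
      a≤t+k {t} b≤t = subst (toℕ a ≤_) (+-comm k (toℕ t)) (m∸n≤o⇒m≤n+o b≤t)
    -- Otherwise truncation makes `b` the first spot, so the left block takes in everything before
    -- `i`, which is the other case of `reach`.
    k≤a : k ≤ toℕ a
    k≤a with k ℕ.≤? toℕ a
    ... | yes k≤a = k≤a
    ... | no  k≰a = contradiction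
      (≤-antisym left≤ (subst (λ x → toℕ i ≤ x + l) (m≤n⇒m∸n≡0 (≰⇒≥ k≰a)) i≤b+l)) l≢i
    i≤ : toℕ i ≤ toℕ a + (l ∸ k)
    i≤ = +-cancelˡ-≤ k _ _ (begin
      k + toℕ i             ≤⟨ +-monoʳ-≤ k i≤b+l ⟩
      k + (b + l)           ≡⟨ +-assoc k b l ⟨
      k + b + l             ≡⟨ cong (_+ l) (m+[n∸m]≡n k≤a) ⟩
      toℕ a + l             ≤⟨ +-monoʳ-≤ (toℕ a) (m≤n+m∸n l k) ⟩
      toℕ a + (k + (l ∸ k)) ≡⟨ +-assoc (toℕ a) k _ ⟨
      toℕ a + k + (l ∸ k)   ≡⟨ cong (_+ (l ∸ k)) (+-comm (toℕ a) k) ⟩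
      k + toℕ a + (l ∸ k)   ≡⟨ +-assoc k (toℕ a) _ ⟩
      k + (toℕ a + (l ∸ k)) ∎)
      where open ≤-Reasoning

  -- When exactly the cars smaller than entry σ i stand in their spots of σ,
  -- the first empty spot that a car preferring a checks is i.
  Parks : Fin n → Set
  Parks a = toℕ a ≤ toℕ i + k ×
            (∀ t → toℕ a ≤ toℕ t + k → Before a t i → entry σ t Fin.< entry σ i)

  -- A car preferring `a` at or after `i` backs up to `i`, so the spots from `i` to `a` form a right
  -- block. A car preferring an earlier spot drives forward to `i`, which requires `Clear a`. In
  -- either case the other bound is immediate.
  Parks⇒interval : ∀ {a} → Parks a → toℕ i ≤ toℕ a + reach × toℕ a < toℕ i + r
  Parks⇒interval {a} (a≤ , smaller) with toℕ i ℕ.≤? toℕ a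
  ... | yes i≤a = ≤-trans i≤a (m≤m+n _ reach) , RightBlock⇒< (i≤a , a≤ , block)
    where
    block : ∀ t → i Fin.≤ t → t Fin.≤ a → entry σ t Fin.≤ entry σ i
    block t i≤t t≤a with toℕ i ℕ.≟ toℕ t
    ... | yes i≡t = ≤-reflexive (cong (toℕ ∘ entry σ) (sym (toℕ-injective i≡t)))
    ... | no  i≢t = <⇒≤ (smaller t
      (≤-trans a≤ (+-monoˡ-≤ k i≤t)) (inj₁ (≤∧≢⇒< i≤t i≢t , t≤a)))
  ... | no  i≰a =
    Clear⇒≤reach (≰⇒> i≰a) (λ t a≤t t<i → smaller t a≤t (inj₂ (t<i , ≰⇒> i≰a))) ,
    ≤-trans (≰⇒> i≰a) (m≤m+n _ r)

  interval⇒Parks : Injective _≡_ _≡_ (entry σ) →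
                   ∀ {a} → toℕ i ≤ toℕ a + reach → toℕ a < toℕ i + r → Parks a
  interval⇒Parks inj {a} i≤ a< with toℕ i ℕ.≤? toℕ a
  ... | no  i≰a = ≤-trans (<⇒≤ (≰⇒> i≰a)) (m≤m+n _ k) , λ where
    t a≤t (inj₁ (i<t , t≤a)) → contradiction (≤-trans (<⇒≤ i<t) t≤a) i≰a
    t a≤t (inj₂ (t<i , _))   → ≤reach⇒Clear (≰⇒> i≰a) i≤ t a≤t t<i
  ... | yes i≤a with <⇒RightBlock i≤a a<
  ... | _ , a≤i+k , block = a≤i+k , λ where
    -- A right block only gives a weak inequality; injectivity makes it strict away from `i`.
    t a≤t (inj₁ (i<t , t≤a)) → ≤∧≢⇒< (block t (<⇒≤ i<t) t≤a)
      (λ eq → <⇒≢ i<t (cong toℕ (sym (inj (toℕ-injective eq)))))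
    t a≤t (inj₂ (_ , a<i))   → contradiction i≤a (<⇒≱ a<i)

-- Streets during parking

lookup-ext : {v w : Vec A n} → lookup v ≗ lookup w → v ≡ w
lookup-ext {v = v} {w} eq =
  trans (sym (tabulate∘lookup v)) (trans (tabulate-cong eq) (tabulate∘lookup w))

-- The street with exactly the first m cars parked in their spots of w.
street : Word n → ℕ → Street n
street w m = tabulate λ s →
  if does (toℕ (lookup w s) ℕ.<? m) then just (lookup w s) else nothing

module _ (w : Word n) where

  street-occupied : ∀ {m} s → toℕ (lookup w s) < m → lookup (street w m) s ≡ just (lookup w s)
  street-occupied {m} s ws<m = trans (lookup∘tabulate _ s)
    (cong (if_then just (lookup w s) else nothing) (dec-true (toℕ (lookup w s) ℕ.<? m) ws<m))

  street-empty : ∀ {m} s → ¬ toℕ (lookup w s) < m → lookup (street w m) s ≡ nothing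
  street-empty {m} s ws≮m = trans (lookup∘tabulate _ s)
    (cong (if_then just (lookup w s) else nothing) (dec-false (toℕ (lookup w s) ℕ.<? m) ws≮m))

  street-just : ∀ {m c} s → lookup (street w m) s ≡ just c → lookup w s ≡ c
  street-just {m} s eq with toSum (toℕ (lookup w s) ℕ.<? m)
  ... | inj₁ ws<m = just-injective (trans (sym (street-occupied s ws<m)) eq)
  ... | inj₂ ws≮m with trans (sym (street-empty s ws≮m)) eq
  ... | ()

  street-fill : Injective _≡_ _≡_ (lookup w) → ∀ i →
                street w (toℕ (lookup w i)) [ i ]≔ just (lookup w i) ≡
                street w (suc (toℕ (lookup w i)))
  street-fill inj i = lookup-ext eq
    where
    m : ℕ
    m = toℕ (lookup w i)
    eq : lookup (street w m [ i ]≔ just (lookup w i)) ≗ lookup (street w (suc m))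
    eq t with t Fin.≟ i
    ... | yes refl = trans (lookup∘update i (street w m) _) (sym (street-occupied i ≤-refl))
    ... | no  t≢i  = trans (lookup∘update′ t≢i (street w m) _) unchanged
      where
      unchanged : lookup (street w m) t ≡ lookup (street w (suc m)) t
      unchanged with toSum (toℕ (lookup w t) ℕ.<? m)
      ... | inj₁ wt<m = trans (street-occupied t wt<m) (sym (street-occupied t (m≤n⇒m≤1+n wt<m)))
      -- Raising the threshold to `suc m` admits only car `m`, whose sole spot is `i`.
      ... | inj₂ wt≮m = trans (street-empty t wt≮m) (sym (street-empty t λ wt≤m →
        t≢i (inj (toℕ-injective (≤-antisym (≤-pred wt≤m) (≮⇒≥ wt≮m))))))

entry-injective : (σ : S n) → Injective _≡_ _≡_ (entry σ)
entry-injective (w , w!) = lookup-injective w! _ _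

module _ (k : ℕ) (σ : S n) where

  private
    w : Word n
    w = proj₁ σ

  Parks⇒findᵇ : ∀ {i a} → Parks k σ i a →
                findᵇ (empty (street w (toℕ (lookup w i)))) (route k a) ≡ just i
  Parks⇒findᵇ {i} (a≤ , smaller) = findᵇ-route⁺ k _ a≤
    (cong is-nothing (street-empty w i (<-irrefl refl)))
    (λ t a≤t before → cong is-nothing (street-occupied w t (smaller t a≤t before)))

  findᵇ⇒Parks : ∀ {i a} → findᵇ (empty (street w (toℕ (lookup w i)))) (route k a) ≡ just i →
                Parks k σ i a
  findᵇ⇒Parks {i} {a} found with findᵇ-route⁻ k _ found
  ... | a≤ , occupied = a≤ , smaller
    where
    smaller : ∀ t → toℕ a ≤ toℕ t + k → Before a t i → lookup w t Fin.< lookup w i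
    smaller t a≤t before with toSum (toℕ (lookup w t) ℕ.<? toℕ (lookup w i))
    ... | inj₁ wt<wi = wt<wi
    ... | inj₂ wt≮wi
      with trans (sym (cong is-nothing (street-empty w t wt≮wi))) (occupied t a≤t before)
    ... | ()

  module _ (α : Word n) where

    ParksAll : Set
    ParksAll = ∀ i → Parks k σ i (lookup α (entry σ i))

    park-street : ParksAll → ∀ {c m} → toℕ c ≡ m →
                  park k c (lookup α c) (street w m) ≡ just (street w (suc m))
    park-street parks {c} refl with injective⇒hits (lookup w) (entry-injective σ) c
    ... | i , refl = trans (cong (Maybe.map _) (Parks⇒findᵇ (parks i)))
                           (cong just (street-fill w (entry-injective σ) i))

    -- For the induction, `f` lists the cars still to come, a tail of `allFin n` that starts at car
    -- `m`.
    parkCars-street : ParksAll → ∀ {m m′} (f : Fin m′ → Fin n) →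
                      (∀ j → toℕ (f j) ≡ m + toℕ j) → m + m′ ≡ n →
                      parkCars k α (List.tabulate f) (street w m) ≡ just (street w n)
    parkCars-street parks {m} {zero}   f f≡ m+0≡n =
      cong (just ∘ street w) (trans (sym (+-identityʳ m)) m+0≡n)
    parkCars-street parks {m} {suc m′} f f≡ m+m′≡n =
      trans (cong (_>>= parkCars k α (List.tabulate (f ∘ suc)))
                  (park-street parks (trans (f≡ zero) (+-identityʳ m))))
            (parkCars-street parks (f ∘ suc)
              (λ j → trans (f≡ (suc j)) (+-suc m (toℕ j))) (trans (sym (+-suc m m′)) m+m′≡n))

    -- Parked cars never move, so the spot that `c` takes now still holds it at the end. It is
    -- therefore the spot of `c` in `w`, and the street stays of the form `street w`.
    parkCars-street⁻ : ∀ {c m} cs → toℕ c ≡ m →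
      parkCars k α (c ∷ cs) (street w m) ≡ just (street w n) →
      (∀ i → lookup w i ≡ c → Parks k σ i (lookup α c)) ×
      parkCars k α cs (street w (suc m)) ≡ just (street w n)
    parkCars-street⁻ {c} {m} cs refl eq
      with findᵇ (empty (street w m)) (route k (lookup α c)) in found
    ... | just s
      with street-just w {n} s (parkCars-keeps k α cs _ eq (lookup∘update s (street w m) (just c)))
    ... | refl =
      (λ i wi≡ws → subst (λ i → Parks k σ i _) (sym (entry-injective σ wi≡ws))
                         (findᵇ⇒Parks found)) ,
      subst (λ L → parkCars k α cs L ≡ just (street w n)) (street-fill w (entry-injective σ) s) eq

    parkCars⇒Parks : ∀ {m m′} (f : Fin m′ → Fin n) → (∀ j → toℕ (f j) ≡ m + toℕ j) →
                     parkCars k α (List.tabulate f) (street w m) ≡ just (street w n) →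
                     ∀ j i → lookup w i ≡ f j → Parks k σ i (lookup α (f j))
    parkCars⇒Parks {m} {suc m′} f f≡ eq j
      with parkCars-street⁻ (List.tabulate (f ∘ suc)) (trans (f≡ zero) (+-identityʳ m)) eq
    parkCars⇒Parks {m} {suc m′} f f≡ eq zero    | parks , _ = parks
    parkCars⇒Parks {m} {suc m′} f f≡ eq (suc j) | _ , eq′ =
      parkCars⇒Parks (f ∘ suc) (λ j → trans (f≡ (suc j)) (+-suc m (toℕ j))) eq′ j

    street₀ : replicate n nothing ≡ street w 0
    street₀ = lookup-ext λ s → trans (lookup-replicate s nothing) (sym (street-empty w {0} s λ ()))

    ParksAll⇒outcome : ParksAll → outcome k α ≡ just (street w n)
    ParksAll⇒outcome parks = trans (cong (parkCars k α (allFin n)) street₀)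
      (parkCars-street parks id (λ _ → refl) refl)

    outcome⇒ParksAll : outcome k α ≡ just (street w n) → ParksAll
    outcome⇒ParksAll eq i = parkCars⇒Parks id (λ _ → refl)
      (trans (cong (parkCars k α (allFin n)) (sym street₀)) eq) (lookup w i) i refl

outcome-φ : ∀ k (p : PF n k) → outcome k (proj₁ p) ≡ just (street (proj₁ (φ k p)) n)
outcome-φ k p@(α , pf) = trans (outcome≡ k α pf) (cong just (lookup-ext λ s →
  trans (lookup-parkedIn k α pf s)
        (sym (trans (street-occupied (proj₁ (φ k p)) s (toℕ<n _))
                    (cong just (lookup∘tabulate (parkedIn k α pf) s))))))

-- With `outcome-φ`, this lets the final street stand for the permutation.
φ-outcome : ∀ k (p : PF n k) {w} → outcome k (proj₁ p) ≡ just (street w n) → proj₁ (φ k p) ≡ w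
φ-outcome k p@(α , pf) {w} eq = lookup-ext λ s →
  trans (lookup∘tabulate (parkedIn k α pf) s) (just-injective
    (trans (sym (lookup-parkedIn k α pf s))
    (trans (cong (λ L → lookup L s) (just-injective (trans (sym (outcome≡ k α pf)) eq)))
           (street-occupied w s (toℕ<n _)))))

-- Parking functions as permutations with slacks

-- The distance from the preference up to the largest one leading to spot `i`; `label` accounts for
-- the strict upper bound of the interval.
slack : ∀ k → S n → Word n → Fin n → ℕ
slack k σ α i = toℕ i + right k σ i ∸ label (lookup α (entry σ i))

label+slack : ∀ k (σ : S n) α → ParksAll k σ α → ∀ i →
              label (lookup α (entry σ i)) + slack k σ α i ≡ toℕ i + right k σ i
label+slack k σ α parks i = m+[n∸m]≡n (proj₂ (Parks⇒interval k σ i (parks i)))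

-- This is the lower end of the interval, whose length is `reach` plus `right`.
slack<ℓ : ∀ k (σ : S n) α → ParksAll k σ α → ∀ i → slack k σ α i < ℓ k σ i
slack<ℓ k σ α parks i = +-cancelˡ-≤ a _ _ (begin
  a + suc (slack k σ α i)               ≡⟨ +-suc a _ ⟩
  suc a + slack k σ α i                 ≡⟨ label+slack k σ α parks i ⟩
  toℕ i + right k σ i                   ≤⟨ +-monoˡ-≤ _ (proj₁ (Parks⇒interval k σ i (parks i))) ⟩
  a + reach k σ i + right k σ i         ≡⟨ +-assoc a _ _ ⟩
  a + (reach k σ i + right k σ i)       ≡⟨ cong (a +_) (reach+right k σ i) ⟩
  a + ℓ k σ i                           ∎)
  where
  open ≤-Reasoning
  a : ℕ
  a = toℕ (lookup α (entry σ i))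

slack-cong : ∀ k (σ τ : S n) α → proj₁ σ ≡ proj₁ τ → slack k σ α ≗ slack k τ α
slack-cong k (w , _) (.w , _) α refl i = refl

-- Every car stands in some spot of `σ`, and the slack there determines its preference.
slack-injective : ∀ k (σ τ : S n) α β → ParksAll k σ α → ParksAll k τ β →
                  proj₁ σ ≡ proj₁ τ → slack k σ α ≗ slack k τ β → α ≡ β
slack-injective k σ@(w , _) τ@(.w , _) α β pα pβ refl slack≡ = lookup-ext eq
  where
  eq : lookup α ≗ lookup β
  eq c with injective⇒hits (entry σ) (entry-injective σ) c
  ... | i , refl = toℕ-injective (ℕₚ.suc-injective (+-cancelʳ-≡ (slack k σ α i) _ _
    (trans (label+slack k σ α pα i)
      (sym (trans (cong (label (lookup β (entry σ i)) +_) (slack≡ i)) (label+slack k τ β pβ i))))))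

module _ (k : ℕ) (σ : S n) (d : Fin n → ℕ) (d<ℓ : ∀ i → d i < ℓ k σ i) where

  private
    r : Fin n → ℕ
    r = right k σ

  d<i+r : ∀ i → d i < toℕ i + r i
  d<i+r i = ≤-trans (d<ℓ i) (subst (_≤ toℕ i + r i) (reach+right k σ i)
    (+-monoˡ-≤ (r i) (reach≤ k σ i)))

  pref-label : ∀ i → suc (toℕ i + r i ∸ suc (d i)) + d i ≡ toℕ i + r i
  pref-label i = trans (sym (+-suc _ (d i))) (m∸n+n≡m (d<i+r i))

  -- The solution `a` of `suc a + d i = toℕ i + r i`: `d<i+r` keeps it from falling below the first
  -- spot, and `right-bound` keeps it on the street.
  pref : Fin n → Fin n
  pref i = fromℕ< (≤-trans (≤-trans (m≤m+n _ (d i)) (≤-reflexive (pref-label i)))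
                           (right-bound k σ i))

  label-pref : ∀ i → label (pref i) + d i ≡ toℕ i + r i
  label-pref i = trans (cong (λ a → suc a + d i) (toℕ-fromℕ< _)) (pref-label i)

  preferences : Word n
  preferences = tabulate λ c → pref (proj₁ (injective⇒hits (entry σ) (entry-injective σ) c))

  lookup-preferences : ∀ i → lookup preferences (entry σ i) ≡ pref i
  lookup-preferences i = trans (lookup∘tabulate _ (entry σ i)) (cong pref (entry-injective σ
    (proj₂ (injective⇒hits (entry σ) (entry-injective σ) (entry σ i)))))

  slack-preferences : slack k σ preferences ≗ d
  slack-preferences i = trans
    (cong₂ _∸_ (sym (label-pref i)) (cong label (lookup-preferences i)))
    (m+n∸m≡n (label (pref i)) (d i))

  preferences-park : ParksAll k σ preferences
  preferences-park i = subst (Parks k σ i) (sym (lookup-preferences i))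
    (interval⇒Parks k σ i (entry-injective σ) i≤
      (≤-trans (m≤m+n _ (d i)) (≤-reflexive (label-pref i))))
    where
    open ≤-Reasoning
    a : ℕ
    a = toℕ (pref i)
    i≤ : toℕ i ≤ a + reach k σ i
    i≤ = +-cancelʳ-≤ (r i) _ _ (begin
      toℕ i + r i                ≡⟨ label-pref i ⟨
      suc a + d i                ≡⟨ +-suc a (d i) ⟨
      a + suc (d i)              ≤⟨ +-monoʳ-≤ a (d<ℓ i) ⟩
      a + ℓ k σ i                ≡⟨ cong (a +_) (reach+right k σ i) ⟨
      a + (reach k σ i + r i)    ≡⟨ +-assoc a _ _ ⟨
      a + reach k σ i + r i      ∎)

φ-ParksAll : ∀ k (p : PF n k) → ParksAll k (φ k p) (proj₁ p)
φ-ParksAll k p = outcome⇒ParksAll k (φ k p) (proj₁ p) (outcome-φ k p)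

-- Matching the two index lists

unique? : Decidable (Unique {A = Fin n} {n})
unique? = allPairs? λ x y → ¬? (x Fin.≟ y)

isPF? : ∀ k → Decidable (IsPF {n} k)
isPF? k α = MaybeAny.dec (λ _ → yes tt) (outcome k α)

-- These index the terms of the sum over permutations. Words replace permutations so that equality
-- of pairs involves no proofs of uniqueness.
slackedPermutations : ∀ n → ℕ → List (Word n × Vec ℕ n)
slackedPermutations n k = concatMap (λ σ → map (proj₁ σ ,_) (box (ℓ k σ))) (permutations n)

withSlack : ∀ k → PF n k → Word n × Vec ℕ n
withSlack k p = proj₁ (φ k p) , tabulate (slack k (φ k p) (proj₁ p))

withSlack-injective : ∀ k (p p′ : PF n k) → withSlack k p ≡ withSlack k p′ → proj₁ p ≡ proj₁ p′
withSlack-injective k p p′ eq =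
  slack-injective k (φ k p) (φ k p′) (proj₁ p) (proj₁ p′) (φ-ParksAll k p) (φ-ParksAll k p′)
    (cong proj₁ eq)
    (λ i → trans (sym (lookup∘tabulate _ i))
      (trans (cong (λ v → lookup v i) (cong proj₂ eq)) (lookup∘tabulate _ i)))

withSlack∈slackedPermutations : ∀ k (p : PF n k) → withSlack k p ∈ slackedPermutations n k
withSlack∈slackedPermutations k p
  with ∈-restrict unique? (∈-tuples (proj₁ (φ k p))) (proj₂ (φ k p))
-- `w!` may differ from the proof that `φ` supplies, but `ℓ` reads only the word.
... | w! , σ∈ = ∈-concatMap⁺ _ (lose σ∈ (∈-map⁺ _ (∈-box⁺ _ λ i →
  subst (_< ℓ k (φ k p) i) (sym (lookup∘tabulate (slack k (φ k p) (proj₁ p)) i))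
    (slack<ℓ k (φ k p) (proj₁ p) (φ-ParksAll k p) i))))

-- The `preferences` built from a word and slacks park with that word as outcome and give back those
-- slacks.
slackedPermutations⊆withSlack : ∀ k {x} → x ∈ slackedPermutations n k →
                                x ∈ map (withSlack k) (parkingFunctions n k)
slackedPermutations⊆withSlack {n} k x∈ with find (∈-concatMap⁻ _ {xs = permutations n} x∈)
... | σ , _ , x∈σ with ∈-map⁻ (proj₁ σ ,_) x∈σ
... | d , d∈ , refl = subst (_∈ map (withSlack k) (parkingFunctions n k)) withSlack≡
  (∈-map⁺ (withSlack k) (proj₂ α∈))
  where
  d<ℓ : ∀ i → lookup d i < ℓ k σ i
  d<ℓ = ∈-box⁻ (ℓ k σ) d∈
  α : Word n
  α = preferences k σ (lookup d) d<ℓ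
  parked : outcome k α ≡ just (street (proj₁ σ) n)
  parked = ParksAll⇒outcome k σ α (preferences-park k σ (lookup d) d<ℓ)
  α∈ : ∃ λ pf → (α , pf) ∈ parkingFunctions n k
  α∈ = ∈-restrict (isPF? k) (∈-tuples α) (subst Is-just (sym parked) (just tt))
  p : PF n k
  p = α , proj₁ α∈
  withSlack≡ : withSlack k p ≡ (proj₁ σ , d)
  withSlack≡ = cong₂ _,_ (φ-outcome k p parked) (lookup-ext λ i →
    trans (lookup∘tabulate _ i)
    (trans (slack-cong k (φ k p) σ α (φ-outcome k p parked) i)
           (slack-preferences k σ (lookup d) d<ℓ i)))

-- Pairs from one permutation differ in their slacks, pairs from different permutations in their
-- words.
slackedPermutations-unique : ∀ n k → L.Unique (slackedPermutations n k)
slackedPermutations-unique n k = Uniqueₚ.concat⁺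
  (Allₚ.map⁺ (All.universal
    (λ σ → Uniqueₚ.map⁺ (cong proj₂) (box-unique (ℓ k σ))) (permutations n)))
  (AllPairsₚ.map⁺ (AllPairs.map (λ {σ} {τ} → disjoint {σ} {τ})
    (restrict-unique unique? (tuples-unique n))))
  where
  disjoint : {σ τ : S n} → proj₁ σ ≢ proj₁ τ →
             Disjoint (map (proj₁ σ ,_) (box (ℓ k σ))) (map (proj₁ τ ,_) (box (ℓ k τ)))
  disjoint {σ} {τ} σ≢τ (∈σ , ∈τ) with ∈-map⁻ (proj₁ σ ,_) ∈σ | ∈-map⁻ (proj₁ τ ,_) ∈τ
  ... | _ , _ , eq | _ , _ , eq′ = σ≢τ (cong proj₁ (trans (sym eq) eq′))

-- Two lists without repetitions that have the same members are rearrangements of each other.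
slackedPermutations↭withSlack : ∀ n k → slackedPermutations n k ↭
                                map (withSlack k) (parkingFunctions n k)
slackedPermutations↭withSlack n k = ∼bag⇒↭ (unique∧set⇒bag (slackedPermutations-unique n k)
  (AllPairsₚ.map⁺ (AllPairs.map (λ {p} {p′} p≢p′ eq → p≢p′ (withSlack-injective k p p′ eq))
    (restrict-unique (isPF? k) (tuples-unique n))))
  (mk⇔ (slackedPermutations⊆withSlack k) withSlack⊆slackedPermutations))
  where
  withSlack⊆slackedPermutations : ∀ {x} → x ∈ map (withSlack k) (parkingFunctions n k) →
                                  x ∈ slackedPermutations n k
  withSlack⊆slackedPermutations x∈ with ∈-map⁻ (withSlack k) x∈
  ... | p , _ , refl = withSlack∈slackedPermutations k p

-- The area

+∸ : ∀ a b {m} → m ≤ a + b → ℤ.+ a ℤ.+ ℤ.+ b ℤ.- ℤ.+ m ≡ ℤ.+ (a + b ∸ m)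
+∸ a b {m} m≤ = trans (ℤₚ.m-n≡m⊖n (a + b) m) (ℤₚ.⊖-≥ m≤)

∑ℤ-+ : (f : Fin n → ℕ) → ∑ℤ (λ i → ℤ.+ f i) ≡ ℤ.+ Vec.sum (tabulate f)
∑ℤ-+ {zero}  f = refl
∑ℤ-+ {suc n} f = cong (ℤ._+_ (ℤ.+ f zero)) (∑ℤ-+ (f ∘ suc))

-- An injective map from a finite set to itself is a permutation, so it only reorders the summands.
∑ℤ-injective : (f : Fin n → ℤ) {g : Fin n → Fin n} → Injective _≡_ _≡_ g →
               ∑ℤ f ≡ ∑ℤ (f ∘ g)
∑ℤ-injective f {g} inj = ℤSum.sum-permute f
  (permutation g (proj₁ ∘ hits) (proj₂ ∘ hits) (λ i → inj (proj₂ (hits (g i)))))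
  where
  hits : ∀ s → ∃ λ c → g c ≡ s
  hits = injective⇒hits g inj

-- Σ (n − i) = Σ (i − 1), and the sum of the preferences may be taken
-- spot by spot, so the area is the sum of the slacks.
area≡sum : ∀ k (p : PF n k) → area k p ≡ ℤ.+ Vec.sum (proj₂ (withSlack k p))
area≡sum {n} k p@(α , _) = begin
  ∑ℤ (λ i → x i ℤ.+ y i ℤ.+ z i)           ≡⟨ ℤSum.∑-distrib-+ (λ i → x i ℤ.+ y i) z ⟩
  ∑ℤ (λ i → x i ℤ.+ y i) ℤ.+ ∑ℤ z          ≡⟨ cong (ℤ._+ ∑ℤ z) (ℤSum.∑-distrib-+ x y) ⟩
  ∑ℤ x ℤ.+ ∑ℤ y ℤ.+ ∑ℤ z                   ≡⟨ cong₂ (λ s t → s ℤ.+ ∑ℤ y ℤ.+ t) ∑x≡∑u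
                                                (∑ℤ-injective z (entry-injective σ)) ⟩
  ∑ℤ u ℤ.+ ∑ℤ y ℤ.+ ∑ℤ (z ∘ entry σ)       ≡⟨ cong (ℤ._+ ∑ℤ (z ∘ entry σ)) (ℤSum.∑-distrib-+ u y) ⟨
  ∑ℤ (λ i → u i ℤ.+ y i) ℤ.+ ∑ℤ (z ∘ entry σ)
                                           ≡⟨ ℤSum.∑-distrib-+ (λ i → u i ℤ.+ y i) (z ∘ entry σ) ⟨
  ∑ℤ (λ i → u i ℤ.+ y i ℤ.+ z (entry σ i)) ≡⟨ ℤSum.sum-cong-≗ (λ i → +∸ (toℕ i) (right k σ i)
                                                (proj₂ (Parks⇒interval k σ i (φ-ParksAll k p i)))) ⟩
  ∑ℤ (λ i → ℤ.+ slack k σ α i)             ≡⟨ ∑ℤ-+ (slack k σ α) ⟩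
  ℤ.+ Vec.sum (tabulate (slack k σ α))     ∎
  where
  open ≡-Reasoning
  σ : S n
  σ = φ k p
  u x y z : Fin n → ℤ
  u i = ℤ.+ toℕ i
  x i = ℤ.+ n ℤ.- ℤ.+ label i
  y i = ℤ.+ right k σ i
  z i = ℤ.- (ℤ.+ label (lookup α i))
  ∑x≡∑u : ∑ℤ x ≡ ∑ℤ u
  ∑x≡∑u = trans
    (ℤSum.sum-cong-≗ {n} λ i → trans (ℤₚ.m-n≡m⊖n n (label i))
      (trans (ℤₚ.⊖-≥ (toℕ<n i)) (cong ℤ.+_ (sym (opposite-prop i)))))
    (sym (ℤSum.sum-permute u reverse))

proposition5p9 : ∀ (n k : ℕ) → 1 ≤ n → k ≤ n ∸ 1 →
    (∑[ σ ∈ permutations n ] ∏ (λ i → [ ℓ k σ i ]q)) ≈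
    (∑[ p ∈ parkingFunctions n k ] (q^ area k p))
proposition5p9 n k _ _ =
  -- Each side is, as a list, the image of its index list under `term`, whose exponent is the sum of
  -- the slacks.
  subst₂ _≈_ (sym lhs) (sym rhs) (coeff-↭ (↭.map⁺ term (slackedPermutations↭withSlack n k)))
  where
  open ≡-Reasoning
  term : Word n × Vec ℕ n → ℤ × ℤ
  term = monomial ∘ Vec.sum ∘ proj₂
  lhs : ∑ (permutations n) (λ σ → ∏ (λ i → [ ℓ k σ i ]q)) ≡ map term (slackedPermutations n k)
  lhs = begin
    ∑ (permutations n) (λ σ → ∏ (λ i → [ ℓ k σ i ]q))
      ≡⟨ ∑≡concatMap (permutations n) _ ⟩
    concatMap (λ σ → ∏ (λ i → [ ℓ k σ i ]q)) (permutations n)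
      ≡⟨ concatMap-cong (λ σ → trans (∏[]q-terms (ℓ k σ)) (map-∘ (box (ℓ k σ))))
                        (permutations n) ⟩
    concatMap (map term ∘ λ σ → map (proj₁ σ ,_) (box (ℓ k σ))) (permutations n)
      ≡⟨ map-concatMap term _ (permutations n) ⟨
    map term (slackedPermutations n k) ∎
  rhs : ∑ (parkingFunctions n k) (λ p → q^ area k p) ≡
        map term (map (withSlack k) (parkingFunctions n k))
  rhs = begin
    ∑ (parkingFunctions n k) (λ p → q^ area k p)
      ≡⟨ ∑-q^ (parkingFunctions n k) (area k) ⟩
    map (λ p → 1ℤ , area k p) (parkingFunctions n k)
      ≡⟨ map-cong (λ p → cong (1ℤ ,_) (area≡sum k p)) (parkingFunctions n k) ⟩
    map (term ∘ withSlack k) (parkingFunctions n k)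
      ≡⟨ map-∘ (parkingFunctions n k) ⟩
    map term (map (withSlack k) (parkingFunctions n k)) ∎
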